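{- Let $\xi=(L^\xi,\Delta_0^\xi,B^\xi,d,G)$ be a generic configuration. The function $G^\xi_1$ is consistency preserving when $\xi$ is EA-stable. Likewise the function $G^\xi_0$ is consistency preserving when $\xi$ is any one of A-stable, E-stable or 0-stable. (Thus in each case $G^\xi_k(\theta)$ is consistent whenever $\theta$ is an r.e. set of $\Pi_1^\xi$ sentences all of which are true in the Standard-M model.)
   Context: **Generic configurations.** Standard-M is the standard model of the natural numbers. $\mathrm{Log}$ is the base-2 logarithm. A generic configuration $\xi$ is a 5-tuple $(L^\xi,\Delta_0^\xi,B^\xi,d,G)$ where: (1) $L^\xi$ is a language with symbols for $0,1,2,=,\le$ and $\mathrm{Maximum}(x,y)$, and enough function and constant symbols that every integer $k$ is the value of some term $T_k$. (2) $\Delta_0^\xi$ is a fixed class of fully bounded $L^\xi$-formulas (all quantifiers have the form $\exists v\le T$ or $\forall v\le T$ with $T$ a term), closed under negation, and rich enough to contain two formulas $\mathrm{Add}(x,y,z)$ and $\mathrm{Mult}(x,y,z)$ defining the graphs of addition and multiplication. Every $\Delta_0^\xi$ formula is both $\Pi_0^\xi$ and $\Sigma_0^\xi$; for $n\ge1$ a formula is $\Pi_n^\xi$ (resp. $\Sigma_n^\xi$) iff it can be written $\forall v_1\cdots\forall v_k\,\Phi$ with $\Phi\in\Sigma_{n-1}^\xi$ (resp. $\exists v_1\cdots\exists v_k\,\Phi$ with $\Phi\in\Pi_{n-1}^\xi$); $\Delta_0^\xi$ sentences count as both $\Pi_1^\xi$ and $\Sigma_1^\xi$. (3) $B^\xi$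 (the base axiom system) is an axiom system whose axioms are true in Standard-M and which is $\Sigma_1^\xi$-complete: it proves every true $\Sigma_1^\xi$ sentence and refutes every false $\Pi_1^\xi$ sentence. (4) $d$ is a deduction method, conventional enough to satisfy the indirect-implication property associated with Gödel's Completeness Theorem: whether or not modus ponens is built in, whenever it can prove $X$, $Y$ and $(X\wedge Y)\to Z$, it can prove $Z$ (possibly by a much longer proof). (5) $G$ is a method for encoding the Gödel numbers of proofs. Proofs are identified with their Gödel numbers $p$. **Goodness.** $E(N)$ is a term of value $2^N$. For a prenex sentence $\Upsilon$, $\mathrm{Scope}_E(\Upsilon,N)$ is obtained from $\Upsilon$ by replacing each unbounded $\forall v$ by $\forall v<E(N)$ and each unbounded $\exists v$ by $\exists v<E(N)$, leaving the bounded quantifiers of the $\Delta_0^\xi$ part unchanged. A $\Pi_1^\xi$ or $\Sigma_1^\xi$ sentence $\Upsilon$ is $\mathrm{Good}(N)$ when $\mathrm{Scope}_E(\Upsilon,N)$ is true in Standard-M ($\mathrm{Good}(\infty)$ means true in Standard-M). For a set $\theta$ of $\Pi_1^\xi$ sentences, $\sharp(\theta)$ is the largest integer $J$ such that every sentence of $\theta$ is $\mathrm{Good}(J)$, and $\sharp(\theta)=\infty$ if this holds for all $J$. **Stability.** $\mathrm{RE\text{ - }Class}(\xi)$ is the set of all recursively enumerable sets $\theta$ of $\Pi_1^\xi$ sentences (true or not). - $\xi$ is A-stable iff for every $\theta\in\mathrm{RE\text{ - }Class}(\xi)$: if $\Upsilon$ is a $\Pi_1^\xi$ theorem of $\theta\cup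 B^\xi$ via a proof $p$ with $\mathrm{Log}(p)\le\sharp(\theta)+1$, then $\Upsilon$ is $\mathrm{Good}\{\tfrac12\sharp(\theta)\}$. - $\xi$ is E-stable iff for every $\theta\in\mathrm{RE\text{ - }Class}(\xi)$: if $\Upsilon$ is a $\Sigma_1^\xi$ theorem of $\theta\cup B^\xi$ via a proof $p$ with $\mathrm{Log}(p)\le\sharp(\theta)+1$, then $\Upsilon$ is $\mathrm{Good}\{\tfrac12\lfloor\mathrm{Log}(p)\rfloor-1\}$. - $\xi$ is EA-stable iff it is both E-stable and A-stable. - $\xi$ is 0-stable iff for every $\theta\in\mathrm{RE\text{ - }Class}(\xi)$: if $\Upsilon$ is a $\Delta_0^\xi$ theorem of $\theta\cup B^\xi$ via a proof $p$ with $\mathrm{Log}(p)\le\sharp(\theta)+1$, then $\Upsilon$ is true in Standard-M. **Self-consistency axioms.** An axiom system $\alpha\supseteq B^\xi$ is Level$(k^\xi)$ consistent when there are no proofs from $\alpha$ via $d$ of both a $\Pi_k^\xi$ sentence and the $\Sigma_k^\xi$ sentence that is its negation. For $\beta\supseteq B^\xi$, $\mathrm{SelfCons}^k(\beta,d)$ is a self-referencing $\Pi_1^\xi$ sentence asserting the Level$(k^\xi)$ consistency of $\beta+\mathrm{SelfCons}^k(\beta,d)$. Explicitly, use $\Delta_0^\xi$ formulas: $\mathrm{Neg}^k(x,y)$: $x$ is the Gödel number of a $\Pi_k^\xi$ sentence and $y$ that of the $\Sigma_k^\xi$ sentence which is its negation; $\mathrm{SubstPrf}^d_\beta(g,t,p)$: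 there is $h$ such that $h$ encodes the sentence obtained from the formula with code $g$ by replacing its free variables by the numeral $\bar g$, and $p$ is a proof of $t$ via $d$ from $\beta$ together with the sentence coded by $h$. Let $\Gamma^k(g)$ be $\forall x\forall y\forall p\forall q\ \neg\{\mathrm{Neg}^k(x,y)\wedge\mathrm{SubstPrf}^d_\beta(g,x,p)\wedge\mathrm{SubstPrf}^d_\beta(g,y,q)\}$ and $n$ its Gödel number; then $\mathrm{SelfCons}^k(\beta,d)$ is $\Gamma^k(\bar n)$. **The functions $G^\xi_k$.** For $k\in\{0,1\}$ and an r.e. set $\theta$ of $\Pi_1^\xi$ sentences (not required to be true), $$G^\xi_k(\theta)=\theta\cup B^\xi\cup\mathrm{SelfCons}^k\{[\theta\cup B^\xi],d\}.$$ The function $G^\xi_k$ (mapping $\theta$ to $G^\xi_k(\theta)$) is consistency preserving iff $G^\xi_k(\theta)$ is consistent whenever all the sentences in $\theta$ are true in Standard-M. -}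

module Defs where

open import Data.Fin using (Fin; zero; suc)
open import Data.Fin.Patterns using (0F; 1F; 2F; 3F; 4F)
open import Data.Integer using (ℤ; +_; -[1+_]; _⊖_)
open import Data.List using (List)
open import Data.List.Relation.Unary.All using (All)
open import Data.Nat using (ℕ; zero; suc; _+_; _*_; _^_; _⊔_; _≤_; _<_; _≤?_; s≤s; z≤n; NonZero)
open import Data.Nat.Logarithm using (⌊log₂_⌋)
open import Data.Nat.Properties
  using (≤-trans; ≤-refl; <-≤-trans; ≤-<-trans; m<n⇒m<1+n; ≰⇒>; m<1+n⇒m≤n; *-mono-≤; <⇒≱; m≤n+m; n≤1+n)
open import Data.Product using (∃; ∃-syntax; _×_; _,_)
open import Data.Unit using (⊤)
open import Data.Vec using (Vec; []; _∷_; lookup; map; tabulate; replicate)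
open import Function using (_∘_)
open import Function.Bundles using (_⇔_)
open import Level using (0ℓ)
open import Relation.Binary.PropositionalEquality using (_≡_)
open import Relation.Nullary using (¬_; yes; no)
open import Relation.Nullary.Construct.Add.Supremum using (_⁺; ⊤⁺; [_])
open import Relation.Unary using (Pred; _∪_; _∈_; _⊆_; _≐_; ｛_｝)

------------------------------------------------------------------------
-- Recursively enumerable sets of naturals: domains of partial recursive
-- (μ-recursive) functions.

data Rec : ℕ → Set where
  zer  : ∀ {n} → Rec n
  succ : Rec 1
  proj : ∀ {n} → Fin n → Rec n
  comp : ∀ {m n} → Rec m → Vec (Rec n) m → Rec n
  prec : ∀ {n} → Rec n → Rec (suc (suc n)) → Rec (suc n)
  mu   : ∀ {n} → Rec (suc n) → Rec n

infix 4 _⟨_⟩⇓_ _⟨_⟩⇓*_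

data _⟨_⟩⇓_  : ∀ {n} → Rec n → Vec ℕ n → ℕ → Set
data _⟨_⟩⇓*_ : ∀ {m n} → Vec (Rec n) m → Vec ℕ n → Vec ℕ m → Set

data _⟨_⟩⇓_ where
  zer⇓  : ∀ {n} {xs : Vec ℕ n} → zer ⟨ xs ⟩⇓ 0
  succ⇓ : ∀ {x} → succ ⟨ x ∷ [] ⟩⇓ suc x
  proj⇓ : ∀ {n} {xs : Vec ℕ n} {i} → proj i ⟨ xs ⟩⇓ lookup xs i
  comp⇓ : ∀ {m n} {f : Rec m} {gs : Vec (Rec n) m} {xs ys z} →
          gs ⟨ xs ⟩⇓* ys → f ⟨ ys ⟩⇓ z → comp f gs ⟨ xs ⟩⇓ z
  prec0 : ∀ {n} {f : Rec n} {g xs y} →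
          f ⟨ xs ⟩⇓ y → prec f g ⟨ 0 ∷ xs ⟩⇓ y
  precS : ∀ {n} {f : Rec n} {g xs k y z} →
          prec f g ⟨ k ∷ xs ⟩⇓ y → g ⟨ k ∷ y ∷ xs ⟩⇓ z →
          prec f g ⟨ suc k ∷ xs ⟩⇓ z
  mu⇓   : ∀ {n} {f : Rec (suc n)} {xs k} →
          (∀ {i} → i < k → ∃[ z ] f ⟨ i ∷ xs ⟩⇓ suc z) →
          f ⟨ k ∷ xs ⟩⇓ 0 → mu f ⟨ xs ⟩⇓ k

data _⟨_⟩⇓*_ where
  []  : ∀ {n} {xs : Vec ℕ n} → [] ⟨ xs ⟩⇓* []
  _∷_ : ∀ {m n} {g : Rec n} {gs : Vec (Rec n) m} {xs y ys} →
        g ⟨ xs ⟩⇓ y → gs ⟨ xs ⟩⇓* ys → (g ∷ gs) ⟨ xs ⟩⇓* (y ∷ ys)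

RecEnum : Pred ℕ 0ℓ → Set
RecEnum A = ∃[ f ] ∀ x → (x ∈ A) ⇔ (∃[ y ] f ⟨ x ∷ [] ⟩⇓ y)

------------------------------------------------------------------------
-- Powers of two with half-integer exponents

⌈√_⌉ : ℕ → ℕ
⌈√ zero ⌉ = 0
⌈√ suc m ⌉ with suc m ≤? ⌈√ m ⌉ * ⌈√ m ⌉
... | yes _ = ⌈√ m ⌉
... | no  _ = suc ⌈√ m ⌉

m≤⌈√m⌉² : ∀ m → m ≤ ⌈√ m ⌉ * ⌈√ m ⌉
m≤⌈√m⌉² zero = z≤n
m≤⌈√m⌉² (suc m) with suc m ≤? ⌈√ m ⌉ * ⌈√ m ⌉
... | yes p = p
... | no  _ = s≤s (≤-trans (m≤⌈√m⌉² m)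
                (≤-trans (*-mono-≤ (≤-refl {⌈√ m ⌉}) (n≤1+n ⌈√ m ⌉))
                         (m≤n+m _ ⌈√ m ⌉)))

v<⌈√m⌉⇒v²<m : ∀ m {v} → v < ⌈√ m ⌉ → v * v < m
v<⌈√m⌉⇒v²<m (suc m) v< with suc m ≤? ⌈√ m ⌉ * ⌈√ m ⌉
... | yes _ = m<n⇒m<1+n (v<⌈√m⌉⇒v²<m m v<)
... | no ¬p = ≤-<-trans (*-mono-≤ (m<1+n⇒m≤n v<) (m<1+n⇒m≤n v<)) (≰⇒> ¬p)

v²<m⇒v<⌈√m⌉ : ∀ m {v} → v * v < m → v < ⌈√ m ⌉
v²<m⇒v<⌈√m⌉ m v²< = ≰⇒> λ r≤v →
  <⇒≱ (<-≤-trans v²< (m≤⌈√m⌉² m)) (*-mono-≤ r≤v r≤v)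

-- The exponents occurring below (½♯(θ), ½⌊Log p⌋ - 1) are half-integers;
-- h : ℤ stands for the exponent h/2.  For natural v,
-- v < 2^(h/2) iff v < ⌈2^(h/2)⌉, and ⌈2^(h/2)⌉ = 1 when h < 0.
⌈2^½_⌉ : ℤ → ℕ
⌈2^½ + h ⌉      = ⌈√ (2 ^ h) ⌉
⌈2^½ -[1+ _ ] ⌉ = 1

------------------------------------------------------------------------
-- Syntax and Standard-M

-- The only relation symbols are = and ≤.
record Signature : Set₁ where
  field
    Fun : ℕ → Set
    ⟦_⟧ : ∀ {a} → Fun a → Vec ℕ a → ℕ

module Syntax (S : Signature) where
  open Signature S

  data Term (n : ℕ) : Set where
    var : Fin n → Term n
    app : ∀ {a} → Fun a → Vec (Term n) a → Term n

  infix  8 _≈′_ _≤′_ _<′_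
  infix  7 ¬′_
  infixl 6 _∧′_
  infixl 5 _∨′_
  infixr 4 _⇒′_

  -- De Bruijn indices: variable 0 is bound by the innermost quantifier.
  -- The bound of ∀≤ and ∃≤ lives outside the scope of the quantifier.
  data Formula (n : ℕ) : Set where
    _≈′_ _≤′_      : Term n → Term n → Formula n
    ¬′_            : Formula n → Formula n
    _∧′_ _∨′_ _⇒′_ : Formula n → Formula n → Formula n
    ∀′ ∃′          : Formula (suc n) → Formula n
    ∀≤ ∃≤          : Term n → Formula (suc n) → Formula n

  Sentence : Set
  Sentence = Formula 0

  Axioms : Set₁
  Axioms = Pred Sentence 0ℓ

  _<′_ : ∀ {n} → Term n → Term n → Formula n
  s <′ t = s ≤′ t ∧′ ¬′ (s ≈′ t)

  mutual
    substᵗ : ∀ {m n} → Vec (Term n) m → Term m → Term n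
    substᵗ σ (var i)    = lookup σ i
    substᵗ σ (app f ts) = app f (substᵗˢ σ ts)

    substᵗˢ : ∀ {m n a} → Vec (Term n) m → Vec (Term m) a → Vec (Term n) a
    substᵗˢ σ []       = []
    substᵗˢ σ (t ∷ ts) = substᵗ σ t ∷ substᵗˢ σ ts

  closed : ∀ {n} → Term 0 → Term n
  closed = substᵗ []

  lift : ∀ {m n} → Vec (Term n) m → Vec (Term (suc n)) (suc m)
  lift σ = var zero ∷ map (substᵗ (tabulate (var ∘ suc))) σ

  subst : ∀ {m n} → Vec (Term n) m → Formula m → Formula n
  subst σ (s ≈′ t) = substᵗ σ s ≈′ substᵗ σ t
  subst σ (s ≤′ t) = substᵗ σ s ≤′ substᵗ σ t
  subst σ (¬′ φ)   = ¬′ subst σ φ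
  subst σ (φ ∧′ ψ) = subst σ φ ∧′ subst σ ψ
  subst σ (φ ∨′ ψ) = subst σ φ ∨′ subst σ ψ
  subst σ (φ ⇒′ ψ) = subst σ φ ⇒′ subst σ ψ
  subst σ (∀′ φ)   = ∀′ (subst (lift σ) φ)
  subst σ (∃′ φ)   = ∃′ (subst (lift σ) φ)
  subst σ (∀≤ t φ) = ∀≤ (substᵗ σ t) (subst (lift σ) φ)
  subst σ (∃≤ t φ) = ∃≤ (substᵗ σ t) (subst (lift σ) φ)

  mutual
    eval : ∀ {n} → Vec ℕ n → Term n → ℕ
    eval ρ (var i)    = lookup ρ i
    eval ρ (app f ts) = ⟦ f ⟧ (evals ρ ts)

    evals : ∀ {n a} → Vec ℕ n → Vec (Term n) a → Vec ℕ a
    evals ρ []       = []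
    evals ρ (t ∷ ts) = eval ρ t ∷ evals ρ ts

  -- Truth in Standard-M is meant classically, so ∨ and ∃ are read through
  -- their de Morgan duals; this makes Sat ρ φ stable under ¬¬ for every φ.
  Sat : ∀ {n} → Vec ℕ n → Formula n → Set
  Sat ρ (s ≈′ t) = eval ρ s ≡ eval ρ t
  Sat ρ (s ≤′ t) = eval ρ s ≤ eval ρ t
  Sat ρ (¬′ φ)   = ¬ Sat ρ φ
  Sat ρ (φ ∧′ ψ) = Sat ρ φ × Sat ρ ψ
  Sat ρ (φ ∨′ ψ) = ¬ (¬ Sat ρ φ × ¬ Sat ρ ψ)
  Sat ρ (φ ⇒′ ψ) = Sat ρ φ → Sat ρ ψ
  Sat ρ (∀′ φ)   = ∀ v → Sat (v ∷ ρ) φ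
  Sat ρ (∃′ φ)   = ¬ (∀ v → ¬ Sat (v ∷ ρ) φ)
  Sat ρ (∀≤ t φ) = ∀ v → v ≤ eval ρ t → Sat (v ∷ ρ) φ
  Sat ρ (∃≤ t φ) = ¬ (∀ v → v ≤ eval ρ t → ¬ Sat (v ∷ ρ) φ)

  True : Sentence → Set
  True = Sat []

  data FullyBounded {n : ℕ} : Formula n → Set where
    eq  : ∀ {s t} → FullyBounded (s ≈′ t)
    le  : ∀ {s t} → FullyBounded (s ≤′ t)
    neg : ∀ {φ} → FullyBounded φ → FullyBounded (¬′ φ)
    and : ∀ {φ ψ} → FullyBounded φ → FullyBounded ψ → FullyBounded (φ ∧′ ψ)
    or  : ∀ {φ ψ} → FullyBounded φ → FullyBounded ψ → FullyBounded (φ ∨′ ψ)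
    imp : ∀ {φ ψ} → FullyBounded φ → FullyBounded ψ → FullyBounded (φ ⇒′ ψ)
    all : ∀ {t φ} → FullyBounded φ → FullyBounded (∀≤ t φ)
    ex  : ∀ {t φ} → FullyBounded φ → FullyBounded (∃≤ t φ)

  -- The negation of a prenex formula, again in prenex form; the remaining
  -- clause is reached at the fully bounded matrix.
  negate : ∀ {n} → Formula n → Formula n
  negate (∀′ φ) = ∃′ (negate φ)
  negate (∃′ φ) = ∀′ (negate φ)
  negate φ      = ¬′ φ

------------------------------------------------------------------------
-- Generic configurations

record Language : Set₁ where
  field
    signature : Signature
  open Signature signature public
  open Syntax signature public
  field
    `0 `1 `2 : Fun 0
    maximum  : Fun 2
    ⟦0⟧      : ⟦ `0 ⟧ [] ≡ 0
    ⟦1⟧      : ⟦ `1 ⟧ [] ≡ 1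
    ⟦2⟧      : ⟦ `2 ⟧ [] ≡ 2
    ⟦max⟧    : ∀ x y → ⟦ maximum ⟧ (x ∷ y ∷ []) ≡ x ⊔ y
    numeral  : ℕ → Term 0
    ⟦num⟧    : ∀ k → eval [] (numeral k) ≡ k

record BoundedClass (L : Language) : Set₁ where
  open Language L
  field
    Δ₀      : ∀ {n} → Pred (Formula n) 0ℓ
    bounded : ∀ {n} {φ : Formula n} → φ ∈ Δ₀ → FullyBounded φ
    ¬-closed : ∀ {n} {φ : Formula n} → φ ∈ Δ₀ → ¬′ φ ∈ Δ₀
    add mult : Formula 3
    add∈Δ₀   : add ∈ Δ₀
    mult∈Δ₀  : mult ∈ Δ₀
    add-graph  : ∀ x y z → Sat (x ∷ y ∷ z ∷ []) add  ⇔ (x + y ≡ z)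
    mult-graph : ∀ x y z → Sat (x ∷ y ∷ z ∷ []) mult ⇔ (x * y ≡ z)

  mutual
    data Π : ∀ (k : ℕ) {n} → Formula n → Set where
      Δ₀⇒Π  : ∀ {n} {φ : Formula n} → φ ∈ Δ₀ → Π 0 φ
      Σ⇒Π   : ∀ {k n} {φ : Formula n} → Σ k φ → Π (suc k) φ
      all-Π : ∀ {k n} {φ : Formula (suc n)} → Π (suc k) φ → Π (suc k) (∀′ φ)

    data Σ : ∀ (k : ℕ) {n} → Formula n → Set where
      Δ₀⇒Σ : ∀ {n} {φ : Formula n} → φ ∈ Δ₀ → Σ 0 φ
      Π⇒Σ  : ∀ {k n} {φ : Formula n} → Π k φ → Σ (suc k) φ
      ex-Σ : ∀ {k n} {φ : Formula (suc n)} → Σ (suc k) φ → Σ (suc k) (∃′ φ)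

-- Modus ponens need not be a rule.  Of soundness, only the preservation of
-- truth in Standard-M is required.
record DeductionMethod (L : Language) : Set₁ where
  open Language L
  field
    Proof      : Set
    premises   : Proof → List Sentence
    conclusion : Proof → Sentence
    sound      : ∀ π → All True (premises π) → True (conclusion π)

  _ProofFrom_ : Proof → Axioms → Set
  π ProofFrom α = All α (premises π)

  infix 4 _⊢_
  _⊢_ : Axioms → Sentence → Set
  α ⊢ X = ∃[ π ] (π ProofFrom α × conclusion π ≡ X)

  field
    indirect-implication : ∀ (α : Axioms) {X Y Z} →
      α ⊢ X → α ⊢ Y → α ⊢ (X ∧′ Y ⇒′ Z) → α ⊢ Z

  Consistent : Axioms → Set
  Consistent α = ¬ (∃[ X ] (α ⊢ X × α ⊢ ¬′ X))

-- Encodes α p π: p is the Gödel number of π as a proof from α.  Numberings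
-- independent of α are the special case in which α is ignored; dependence on
-- α lets p also carry evidence that the premises belong to α.  Numbers of
-- proofs are positive because their logarithms are taken.
record Encoding (L : Language) (d : DeductionMethod L) : Set₁ where
  open Language L
  open DeductionMethod d
  field
    ⌜_⌝          : ∃ Formula → ℕ
    ⌜⌝-injective : ∀ {φ ψ} → ⌜ φ ⌝ ≡ ⌜ ψ ⌝ → φ ≡ ψ
    Encodes      : Axioms → ℕ → Proof → Set
    encodable    : ∀ {α π} → π ProofFrom α → ∃[ p ] Encodes α p π
    decodable    : ∀ {α p π π′} → Encodes α p π → Encodes α p π′ → π ≡ π′
    positive     : ∀ {α p π} → Encodes α p π → NonZero p
    extensional  : ∀ {α β p π} → α ≐ β → Encodes α p π → Encodes β p π

  ⌜_⌝ˢ : Sentence → ℕ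
  ⌜ X ⌝ˢ = ⌜ 0 , X ⌝

  Prf : Axioms → Sentence → ℕ → Set
  Prf α X p = ∃[ π ] (π ProofFrom α × conclusion π ≡ X × Encodes α p π)

record BaseSystem (L : Language) (Δ : BoundedClass L) (d : DeductionMethod L) : Set₁ where
  open Language L
  open BoundedClass Δ
  open DeductionMethod d
  field
    B          : Axioms
    B-true     : B ⊆ True
    Σ₁-proves  : ∀ {X} → Σ 1 X → True X → B ⊢ X
    Π₁-refutes : ∀ {X} → Π 1 X → ¬ True X → B ⊢ ¬′ X

record GenericConfiguration : Set₁ where
  field
    L : Language
    Δ : BoundedClass L
    d : DeductionMethod L
    G : Encoding L d
    base : BaseSystem L Δ d
  open Language L public
  open BoundedClass Δ public
  open DeductionMethod d public
  open Encoding G public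
  open BaseSystem base public

------------------------------------------------------------------------

module _ (ξ : GenericConfiguration) where
  open GenericConfiguration ξ

  -- E h is a closed term such that v < E h iff v < 2^(h/2).
  E : ℤ → Term 0
  E h = numeral ⌈2^½ h ⌉

  -- Applied to prenex formulas; the remaining clause is reached at the
  -- fully bounded matrix.
  Scope : ∀ {n} → ℤ → Formula n → Formula n
  Scope h (∀′ φ) = ∀≤ (closed (E h)) (var zero <′ closed (E h) ⇒′ Scope h φ)
  Scope h (∃′ φ) = ∃≤ (closed (E h)) (var zero <′ closed (E h) ∧′ Scope h φ)
  Scope h φ      = φ

  -- Good [ h ] is goodness at the exponent h/2.
  Good : ℤ ⁺ → Sentence → Set
  Good [ h ] X = True (Scope h X)
  Good ⊤⁺    X = True X

  AllGood : ℕ → Axioms → Set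
  AllGood J θ = ∀ {X} → X ∈ θ → Good [ + (2 * J) ] X

  -- ♯ θ s says that ♯(θ) is s.  No s satisfies this when θ is not even
  -- Good(0), and the stability conditions then demand nothing of θ.
  ♯ : Axioms → ℕ ⁺ → Set
  ♯ θ [ J ] = AllGood J θ × (∀ J′ → AllGood J′ θ → J′ ≤ J)
  ♯ θ ⊤⁺    = ∀ J → AllGood J θ

  ½ : ℕ ⁺ → ℤ ⁺
  ½ [ J ] = [ + J ]
  ½ ⊤⁺    = ⊤⁺

  -- Log p ≤ s + 1
  Log_≤1+_ : ℕ → ℕ ⁺ → Set
  Log p ≤1+ [ J ] = p ≤ 2 ^ (1 + J)
  Log p ≤1+ ⊤⁺    = ⊤

  REClass : Axioms → Set
  REClass θ = (∀ {X} → X ∈ θ → Π 1 X)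
            × RecEnum (λ x → ∃[ X ] (X ∈ θ × ⌜ X ⌝ˢ ≡ x))

  AStable : Set₁
  AStable = ∀ θ → REClass θ → ∀ s → ♯ θ s →
            ∀ X p → Π 1 X → Prf (θ ∪ B) X p → Log p ≤1+ s → Good (½ s) X

  -- ⌊log₂ p ⌋ ⊖ 2 halves to ½⌊Log p⌋ - 1.
  EStable : Set₁
  EStable = ∀ θ → REClass θ → ∀ s → ♯ θ s →
            ∀ X p → Σ 1 X → Prf (θ ∪ B) X p → Log p ≤1+ s →
            Good [ ⌊log₂ p ⌋ ⊖ 2 ] X

  EAStable : Set₁
  EAStable = EStable × AStable

  ZeroStable : Set₁
  ZeroStable = ∀ θ → REClass θ → ∀ s → ♯ θ s →
               ∀ X p → X ∈ Δ₀ → Prf (θ ∪ B) X p → Log p ≤1+ s → True X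

  IsDiagonal : ℕ → Sentence → Set
  IsDiagonal g H = ∃[ n ] ∃[ φ ]
    (⌜ n , φ ⌝ ≡ g × H ≡ subst (replicate n (numeral g)) φ)

  -- The Δ₀ formulas from which SelfCons^k(β,d) is built.  Closure of Δ₀
  -- under ∧ and substitution is not assumed, so that the resulting sentence
  -- is Π₁ is a requirement on these formulas.
  record Arithmetization (k : ℕ) (β : Axioms) : Set where
    field
      Neg           : Formula 2
      Neg∈Δ₀        : Neg ∈ Δ₀
      Neg-spec      : ∀ x y → Sat (x ∷ y ∷ []) Neg ⇔
                      (∃[ X ] (Π k X × ⌜ X ⌝ˢ ≡ x × ⌜ negate X ⌝ˢ ≡ y))
      SubstPrf      : Formula 3
      SubstPrf∈Δ₀   : SubstPrf ∈ Δ₀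
      SubstPrf-spec : ∀ g t p → Sat (g ∷ t ∷ p ∷ []) SubstPrf ⇔
                      (∃[ h ] ∃[ H ] ∃[ T ]
                        (IsDiagonal g H × ⌜ H ⌝ˢ ≡ h × ⌜ T ⌝ˢ ≡ t
                         × Prf (β ∪ ｛ H ｝) T p))

    -- Indices 0–4 are q, p, y, x, g.
    Γ : Formula 1
    Γ = ∀′ (∀′ (∀′ (∀′ (¬′
          ( subst (var 3F ∷ var 2F ∷ []) Neg
          ∧′ subst (var 4F ∷ var 3F ∷ var 1F ∷ []) SubstPrf
          ∧′ subst (var 4F ∷ var 2F ∷ var 0F ∷ []) SubstPrf)))))

    SelfCons : Sentence
    SelfCons = subst (numeral ⌜ 1 , Γ ⌝ ∷ []) Γ

    field
      SelfCons-Π₁ : Π 1 SelfCons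

  𝔾 : (k : ℕ) (θ : Axioms) → Arithmetization k (θ ∪ B) → Axioms
  𝔾 k θ A = (θ ∪ B) ∪ ｛ Arithmetization.SelfCons A ｝

  ConsistencyPreserving : ℕ → Set₁
  ConsistencyPreserving k =
    ∀ θ → REClass θ → (A : Arithmetization k (θ ∪ B)) →
    θ ⊆ True → Consistent (𝔾 k θ A)

-- SelfCons is in fact true when θ is.  By induction on J, no refutation of
-- it (a quadruple x, y, p, q) lies below 2^J.  If one lay below 2^(J+1) but
-- none below 2^J, then ♯(θ ∪ {SelfCons}) = J exactly, so Log p and Log q are
-- at most ♯ + 1, and stability makes X and its negation simultaneously Good
-- at comparable exponents.  Hence all axioms of 𝔾 are true in Standard-M, and
-- soundness yields consistency.

{-# OPTIONS --safe #-}
module Submission where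

open import Defs
open import Data.Empty using (⊥)
open import Data.Fin using (zero; suc)
open import Data.Fin.Patterns using (0F; 1F; 2F; 3F; 4F)
open import Data.Integer using (+_; _⊖_)
open import Data.List.Relation.Unary.All as All using ()
open import Data.Nat using (ℕ; zero; suc; _+_; _*_; _^_; _≤_; _<_; z≤n; s≤s; >-nonZero⁻¹)
open import Data.Nat.Logarithm using (⌊log₂_⌋; ⌊log₂⌋-mono-≤; ⌊log₂[2^n]⌋≡n)
open import Data.Nat.Properties
open import Data.Product using (_×_; _,_; proj₁; proj₂; ∃-syntax)
open import Data.Sum using (_⊎_; inj₁; inj₂; [_,_]′)
open import Data.Vec using (Vec; []; _∷_; lookup)
open import Data.Vec.Properties using (lookup-map; lookup∘tabulate)
open import Function using (_∘_; id; mk⇔)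
open import Function.Bundles using (_⇔_; module Equivalence)
open import Level using (0ℓ)
open import Relation.Binary.PropositionalEquality as ≡ using (_≡_; refl; sym; trans; cong; cong₂; subst₂)
open import Relation.Nullary using (¬_)
open import Relation.Nullary.Construct.Add.Supremum using ([_]; ⊤⁺)
open import Relation.Unary using (Pred; _∪_; _∈_; _⊆_; _≐_; ｛_｝)

open Equivalence using (to; from)

-- Recursive enumerability

-- Vanishes at `c` and nowhere else: each successor of `c` strips one successor off the argument,
-- and an argument that runs out early gives 1.
distinguish : ℕ → Rec 1
distinguish zero    = proj zero
distinguish (suc c) = prec (comp succ (zer ∷ [])) (comp (distinguish c) (proj zero ∷ []))

distinguish-total : ∀ c x → ∃[ y ] distinguish c ⟨ x ∷ [] ⟩⇓ y
distinguish-total zero    x       = x , proj⇓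
distinguish-total (suc c) zero    = 1 , prec0 (comp⇓ (zer⇓ ∷ []) succ⇓)
distinguish-total (suc c) (suc x) =
  -- The step function discards the recursive value, but `precS` still demands that this value
  -- exist.
  let _ , ih = distinguish-total (suc c) x
      y , e  = distinguish-total c x
  in y , precS ih (comp⇓ (proj⇓ ∷ []) e)

distinguish-self : ∀ c → distinguish c ⟨ c ∷ [] ⟩⇓ 0
distinguish-self zero    = proj⇓
distinguish-self (suc c) =
  precS (proj₂ (distinguish-total (suc c) c)) (comp⇓ (proj⇓ ∷ []) (distinguish-self c))

distinguish⇓0⇒≡ : ∀ c {x} → distinguish c ⟨ x ∷ [] ⟩⇓ 0 → c ≡ x
distinguish⇓0⇒≡ zero    {zero} _                                = refl
distinguish⇓0⇒≡ (suc c) (prec0 (comp⇓ (zer⇓ ∷ []) ()))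
distinguish⇓0⇒≡ (suc c) (precS _ (comp⇓ (proj⇓ ∷ []) e)) = cong suc (distinguish⇓0⇒≡ c e)

-- The recursion on distinguish c x calls f only when x ≢ c.
RecEnum-insert : ∀ {A : Pred ℕ 0ℓ} c → RecEnum A → RecEnum (A ∪ ｛ c ｝)
RecEnum-insert {A} c (f , f-enum) = comp lazy (distinguish c ∷ proj zero ∷ []) , λ x → mk⇔ (halts x) (member x)
  where
  lazy : Rec 2
  lazy = prec zer (comp f (proj 2F ∷ []))

  lazy-halts : ∀ {x y} k → f ⟨ x ∷ [] ⟩⇓ y → ∃[ z ] lazy ⟨ k ∷ x ∷ [] ⟩⇓ z
  lazy-halts zero    e = 0 , prec0 zer⇓
  lazy-halts (suc k) e = _ , precS (proj₂ (lazy-halts k e)) (comp⇓ (proj⇓ ∷ []) e)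

  halts : ∀ x → x ∈ A ∪ ｛ c ｝ → ∃[ y ] comp lazy (distinguish c ∷ proj zero ∷ []) ⟨ x ∷ [] ⟩⇓ y
  halts x (inj₁ x∈A) =
    let k , d = distinguish-total c x
        _ , e = lazy-halts k (proj₂ (to (f-enum x) x∈A))
    in _ , comp⇓ (d ∷ proj⇓ ∷ []) e
  halts x (inj₂ refl) = 0 , comp⇓ (distinguish-self c ∷ proj⇓ ∷ []) (prec0 zer⇓)

  member : ∀ x → ∃[ y ] comp lazy (distinguish c ∷ proj zero ∷ []) ⟨ x ∷ [] ⟩⇓ y → x ∈ A ∪ ｛ c ｝
  member x (_ , comp⇓ (d ∷ proj⇓ ∷ []) (prec0 _)) = inj₂ (distinguish⇓0⇒≡ c d)
  -- A run through `precS` contains a halting run of `f` on x, since `proj 2F` picks x among the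
  -- step arguments.
  member x (_ , comp⇓ (d ∷ proj⇓ ∷ []) (precS _ (comp⇓ (proj⇓ ∷ []) e))) =
    inj₁ (from (f-enum x) (_ , e))

RecEnum-resp-≐ : ∀ {A B : Pred ℕ 0ℓ} → A ≐ B → RecEnum A → RecEnum B
RecEnum-resp-≐ (A⊆B , B⊆A) (f , f-enum) =
  f , λ x → mk⇔ (to (f-enum x) ∘ B⊆A) (A⊆B ∘ from (f-enum x))

-- Powers of two with half-integer exponents

⌈√⌉-mono-≤ : ∀ {a b} → a ≤ b → ⌈√ a ⌉ ≤ ⌈√ b ⌉
⌈√⌉-mono-≤ {a} {b} a≤b = ≮⇒≥ λ √b<√a →
  <⇒≱ (v<⌈√m⌉⇒v²<m a √b<√a) (≤-trans a≤b (m≤⌈√m⌉² b))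

⌈√n²⌉≡n : ∀ n → ⌈√ (n * n) ⌉ ≡ n
⌈√n²⌉≡n n = ≤-antisym
  (≮⇒≥ λ n<√ → <-irrefl refl (v<⌈√m⌉⇒v²<m (n * n) n<√))
  (≮⇒≥ λ √<n → <⇒≱ (*-mono-< √<n √<n) (m≤⌈√m⌉² (n * n)))

⌈2^½2J⌉≡2^J : ∀ J → ⌈2^½ + (2 * J) ⌉ ≡ 2 ^ J
⌈2^½2J⌉≡2^J J = begin
  ⌈√ (2 ^ (2 * J)) ⌉     ≡⟨ cong (λ i → ⌈√ (2 ^ (J + i)) ⌉) (+-identityʳ J) ⟩
  ⌈√ (2 ^ (J + J)) ⌉     ≡⟨ cong ⌈√_⌉ (^-distribˡ-+-* 2 J J) ⟩
  ⌈√ (2 ^ J * 2 ^ J) ⌉   ≡⟨ ⌈√n²⌉≡n (2 ^ J) ⟩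
  2 ^ J                  ∎
  where open ≡.≡-Reasoning

-- In doubled exponents, compares ½m - 1 from E-stability with ½J from A-stability.
⌈2^½⌉-⊖2≤ : ∀ m {J} → m ≤ suc J → ⌈2^½ (m ⊖ 2) ⌉ ≤ ⌈2^½ + J ⌉
-- For m < 2 the exponent is negative and the left side is 1; the right side exceeds 0 because 0 * 0
-- < 2 ^ J.
⌈2^½⌉-⊖2≤ zero          {J} _    = v²<m⇒v<⌈√m⌉ (2 ^ J) (m^n>0 2 J)
⌈2^½⌉-⊖2≤ (suc zero)    {J} _    = v²<m⇒v<⌈√m⌉ (2 ^ J) (m^n>0 2 J)
⌈2^½⌉-⊖2≤ (suc (suc m)) {J} m+2≤ = ⌈√⌉-mono-≤ (^-monoʳ-≤ 2 (≤-trans (n≤1+n m) (≤-pred m+2≤)))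

n<2^n : ∀ n → n < 2 ^ n
n<2^n zero    = s≤s z≤n
n<2^n (suc n) = +-mono-≤-< (m^n>0 2 n) (<-≤-trans (n<2^n n) (m≤m+n (2 ^ n) 0))

⌊log₂⌋≤ : ∀ {p J} → p ≤ 2 ^ J → ⌊log₂ p ⌋ ≤ J
⌊log₂⌋≤ {J = J} p≤ = ≤-trans (⌊log₂⌋-mono-≤ p≤) (≤-reflexive (⌊log₂[2^n]⌋≡n J))

-- Substitution and satisfaction

module _ (S : Signature) where
  open Signature S
  open Syntax S

  record _⊨_↦_ {m n} (ρ : Vec ℕ n) (σ : Vec (Term n) m) (ρ′ : Vec ℕ m) : Set where
    constructor pointwise
    field at : ∀ i → eval ρ (lookup σ i) ≡ lookup ρ′ i
  open _⊨_↦_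

  mutual
    eval-substᵗ : ∀ {m n} {ρ : Vec ℕ n} {σ : Vec (Term n) m} {ρ′} → ρ ⊨ σ ↦ ρ′ →
                  ∀ t → eval ρ (substᵗ σ t) ≡ eval ρ′ t
    eval-substᵗ σ↦ (var i)    = at σ↦ i
    eval-substᵗ σ↦ (app f ts) = cong ⟦ f ⟧ (evals-substᵗˢ σ↦ ts)

    evals-substᵗˢ : ∀ {m n a} {ρ : Vec ℕ n} {σ : Vec (Term n) m} {ρ′} → ρ ⊨ σ ↦ ρ′ →
                    ∀ (ts : Vec _ a) → evals ρ (substᵗˢ σ ts) ≡ evals ρ′ ts
    evals-substᵗˢ σ↦ []       = refl
    evals-substᵗˢ σ↦ (t ∷ ts) = cong₂ _∷_ (eval-substᵗ σ↦ t) (evals-substᵗˢ σ↦ ts)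

  eval-closed : ∀ {n} (ρ : Vec ℕ n) t → eval ρ (closed t) ≡ eval [] t
  eval-closed ρ = eval-substᵗ (pointwise λ ())

  ↦-lift : ∀ {m n} {ρ : Vec ℕ n} {σ : Vec (Term n) m} {ρ′} v → ρ ⊨ σ ↦ ρ′ →
           (v ∷ ρ) ⊨ lift σ ↦ (v ∷ ρ′)
  at (↦-lift v σ↦) zero = refl
  at (↦-lift {ρ = ρ} {σ} v σ↦) (suc i) = trans
    (cong (eval (v ∷ ρ)) (lookup-map i _ σ))
    -- Weakening is itself a substitution, taking `v ∷ ρ` back to `ρ`.
    (trans (eval-substᵗ (pointwise λ j → cong (eval (v ∷ ρ)) (lookup∘tabulate (var ∘ suc) j)) (lookup σ i))
           (at σ↦ i))

  -- Both directions are proved together because negation, implication and the de Morgan readings of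
  -- ∨ and ∃ reverse direction.
  Sat-subst : ∀ {m n} {ρ : Vec ℕ n} {σ : Vec (Term n) m} {ρ′} → ρ ⊨ σ ↦ ρ′ →
              ∀ φ → Sat ρ (subst σ φ) ⇔ Sat ρ′ φ
  Sat-subst σ↦ (s ≈′ t) = mk⇔
    (subst₂ _≡_ (eval-substᵗ σ↦ s) (eval-substᵗ σ↦ t))
    (subst₂ _≡_ (sym (eval-substᵗ σ↦ s)) (sym (eval-substᵗ σ↦ t)))
  Sat-subst σ↦ (s ≤′ t) = mk⇔
    (subst₂ _≤_ (eval-substᵗ σ↦ s) (eval-substᵗ σ↦ t))
    (subst₂ _≤_ (sym (eval-substᵗ σ↦ s)) (sym (eval-substᵗ σ↦ t)))
  Sat-subst σ↦ (¬′ φ) = let φ⇔ = Sat-subst σ↦ φ in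
    mk⇔ (λ ¬φ → ¬φ ∘ from φ⇔) (λ ¬φ → ¬φ ∘ to φ⇔)
  Sat-subst σ↦ (φ ∧′ ψ) = let φ⇔ = Sat-subst σ↦ φ ; ψ⇔ = Sat-subst σ↦ ψ in
    mk⇔ (λ (a , b) → to φ⇔ a , to ψ⇔ b) (λ (a , b) → from φ⇔ a , from ψ⇔ b)
  Sat-subst σ↦ (φ ∨′ ψ) = let φ⇔ = Sat-subst σ↦ φ ; ψ⇔ = Sat-subst σ↦ ψ in
    mk⇔ (λ k (a , b) → k (a ∘ to φ⇔ , b ∘ to ψ⇔)) (λ k (a , b) → k (a ∘ from φ⇔ , b ∘ from ψ⇔))
  Sat-subst σ↦ (φ ⇒′ ψ) = let φ⇔ = Sat-subst σ↦ φ ; ψ⇔ = Sat-subst σ↦ ψ in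
    mk⇔ (λ f → to ψ⇔ ∘ f ∘ from φ⇔) (λ f → from ψ⇔ ∘ f ∘ to φ⇔)
  Sat-subst σ↦ (∀′ φ) = let φ⇔ = λ v → Sat-subst (↦-lift v σ↦) φ in
    mk⇔ (λ f v → to (φ⇔ v) (f v)) (λ f v → from (φ⇔ v) (f v))
  Sat-subst σ↦ (∃′ φ) = let φ⇔ = λ v → Sat-subst (↦-lift v σ↦) φ in
    mk⇔ (λ k f → k λ v → f v ∘ to (φ⇔ v)) (λ k f → k λ v → f v ∘ from (φ⇔ v))
  Sat-subst σ↦ (∀≤ t φ) = let φ⇔ = λ v → Sat-subst (↦-lift v σ↦) φ ; t≡ = eval-substᵗ σ↦ t in
    mk⇔ (λ f v v≤t → to (φ⇔ v) (f v (≤-trans v≤t (≤-reflexive (sym t≡)))))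
        (λ f v v≤t → from (φ⇔ v) (f v (≤-trans v≤t (≤-reflexive t≡))))
  Sat-subst σ↦ (∃≤ t φ) = let φ⇔ = λ v → Sat-subst (↦-lift v σ↦) φ ; t≡ = eval-substᵗ σ↦ t in
    mk⇔ (λ k f → k λ v v≤t → f v (≤-trans v≤t (≤-reflexive t≡)) ∘ to (φ⇔ v))
        (λ k f → k λ v v≤t → f v (≤-trans v≤t (≤-reflexive (sym t≡))) ∘ from (φ⇔ v))

  negate-bounded : ∀ {n} {φ : Formula n} → FullyBounded φ → negate φ ≡ ¬′ φ
  negate-bounded eq        = refl
  negate-bounded le        = refl
  negate-bounded (neg _)   = refl
  negate-bounded (and _ _) = refl
  negate-bounded (or _ _)  = refl
  negate-bounded (imp _ _) = refl
  negate-bounded (all _)   = refl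
  negate-bounded (ex _)    = refl

module _ (ξ : GenericConfiguration) where
  open GenericConfiguration ξ

  -- Scope and goodness

  Scope-bounded : ∀ {n} {φ : Formula n} h → FullyBounded φ → Scope ξ h φ ≡ φ
  Scope-bounded h eq        = refl
  Scope-bounded h le        = refl
  Scope-bounded h (neg _)   = refl
  Scope-bounded h (and _ _) = refl
  Scope-bounded h (or _ _)  = refl
  Scope-bounded h (imp _ _) = refl
  Scope-bounded h (all _)   = refl
  Scope-bounded h (ex _)    = refl

  eval-E : ∀ {n} (ρ : Vec ℕ n) h → eval ρ (closed (E ξ h)) ≡ ⌈2^½ h ⌉
  eval-E ρ h = trans (eval-closed signature ρ (E ξ h)) (⟦num⟧ ⌈2^½ h ⌉)

  Sat-Scope-∀′ : ∀ {n} (ρ : Vec ℕ n) h (φ : Formula (suc n)) →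
    Sat ρ (Scope ξ h (∀′ φ)) ⇔ (∀ v → v < ⌈2^½ h ⌉ → Sat (v ∷ ρ) (Scope ξ h φ))
  Sat-Scope-∀′ ρ h φ = mk⇔
    -- `E` is evaluated twice: in `ρ` as the quantifier bound, and in `v ∷ ρ` in the strict guard
    -- under the binder.
    (λ f v v< → let v<E = <-≤-trans v< (≤-reflexive (sym (eval-E ρ h)))
                    v<E′ = <-≤-trans v< (≤-reflexive (sym (eval-E (v ∷ ρ) h)))
                in f v (<⇒≤ v<E) (<⇒≤ v<E′ , <⇒≢ v<E′))
    (λ f v _ (v≤E , v≢E) → f v (<-≤-trans (≤∧≢⇒< v≤E v≢E) (≤-reflexive (eval-E (v ∷ ρ) h))))

  Sat-Scope-∃′ : ∀ {n} {ρ : Vec ℕ n} h (φ : Formula (suc n)) →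
    Sat ρ (Scope ξ h (∃′ φ)) → ¬ (∀ v → v < ⌈2^½ h ⌉ → ¬ Sat (v ∷ ρ) (Scope ξ h φ))
  Sat-Scope-∃′ {ρ = ρ} h φ k none = k λ v _ ((v≤E , v≢E) , sat) →
    none v (<-≤-trans (≤∧≢⇒< v≤E v≢E) (≤-reflexive (eval-E (v ∷ ρ) h))) sat

  -- The unbounded quantifiers are all universal, so cutting down their ranges only weakens the
  -- formula.
  Sat⇒Sat-Scope : ∀ {n} {φ : Formula n} {ρ} h → Π 1 φ → Sat ρ φ → Sat ρ (Scope ξ h φ)
  Sat⇒Sat-Scope {φ = φ} {ρ} h (Σ⇒Π (Δ₀⇒Σ φ∈Δ₀)) sat =
    ≡.subst (Sat ρ) (sym (Scope-bounded h (bounded φ∈Δ₀))) sat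
  Sat⇒Sat-Scope h (all-Π {φ = φ} Πφ) sat =
    from (Sat-Scope-∀′ _ h φ) λ v _ → Sat⇒Sat-Scope h Πφ (sat v)

  Good-Δ₀ : ∀ {X} s → X ∈ Δ₀ → Good ξ s X → True X
  Good-Δ₀ [ h ] X∈Δ₀ = ≡.subst True (Scope-bounded h (bounded X∈Δ₀))
  Good-Δ₀ ⊤⁺    _    = id

  negate-Δ₀ : ∀ {n} {φ : Formula n} → φ ∈ Δ₀ → negate φ ≡ ¬′ φ
  negate-Δ₀ φ∈Δ₀ = negate-bounded signature (bounded φ∈Δ₀)

  negate-Π₁ : ∀ {n} {φ : Formula n} → Π 1 φ → Σ 1 (negate φ)
  negate-Π₁ (Σ⇒Π (Δ₀⇒Σ φ∈Δ₀)) rewrite negate-Δ₀ φ∈Δ₀ = Π⇒Σ (Δ₀⇒Π (¬-closed φ∈Δ₀))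
  negate-Π₁ (all-Π Πφ)        = ex-Σ (negate-Π₁ Πφ)

  -- A counterexample to φ below the smaller bound `h′` lies in the range where Scope at `h` already
  -- asserts φ.
  Scope-negate-contradiction : ∀ {n} {φ : Formula n} {ρ} h h′ → ⌈2^½ h′ ⌉ ≤ ⌈2^½ h ⌉ → Π 1 φ →
    Sat ρ (Scope ξ h φ) → ¬ Sat ρ (Scope ξ h′ (negate φ))
  Scope-negate-contradiction h h′ h′≤h (Σ⇒Π (Δ₀⇒Σ φ∈Δ₀)) sat
    rewrite negate-Δ₀ φ∈Δ₀ | Scope-bounded h (bounded φ∈Δ₀) = λ ¬sat → ¬sat sat
  Scope-negate-contradiction h h′ h′≤h (all-Π {φ = φ} Πφ) sat sat′ =
    Sat-Scope-∃′ h′ (negate φ) sat′ λ v v< →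
      Scope-negate-contradiction h h′ h′≤h Πφ (to (Sat-Scope-∀′ _ h φ) sat v (<-≤-trans v< h′≤h))

  -- Consistency preservation

  REClass-insert : ∀ {θ X} → Π 1 X → REClass ξ θ → REClass ξ (θ ∪ ｛ X ｝)
  REClass-insert {θ} {X} ΠX (θ⊆Π₁ , θ-re) =
      (λ { (inj₁ Y∈θ) → θ⊆Π₁ Y∈θ ; (inj₂ refl) → ΠX })
    , RecEnum-resp-≐
        ( (λ { (inj₁ (Y , Y∈θ , e)) → Y , inj₁ Y∈θ , e ; (inj₂ e) → X , inj₂ refl , e })
        , (λ { (Y , inj₁ Y∈θ , e) → inj₁ (Y , Y∈θ , e) ; (_ , inj₂ refl , e) → inj₂ e }))
        (RecEnum-insert ⌜ X ⌝ˢ θ-re)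

  Prf-resp-≐ : ∀ {α β X p} → α ≐ β → Prf α X p → Prf β X p
  Prf-resp-≐ α≐β (π , fromα , concl , enc) =
    π , All.map (proj₁ α≐β) fromα , concl , extensional α≐β enc

  Prf-positive : ∀ {α X p} → Prf α X p → 0 < p
  Prf-positive (_ , _ , _ , enc) = >-nonZero⁻¹ _ ⦃ positive enc ⦄

  ⌜⌝ˢ-injective : ∀ {X Y} → ⌜ X ⌝ˢ ≡ ⌜ Y ⌝ˢ → X ≡ Y
  ⌜⌝ˢ-injective e with refl ← ⌜⌝-injective e = refl

  -- What the induction takes from stability, in a form shared by k = 0 and k = 1. The bound 2 ^ suc
  -- J expresses Log p ≤ ♯(θ) + 1.
  NoShortContradiction : ℕ → Set₁
  NoShortContradiction k = ∀ {θ} → REClass ξ θ → ∀ {J} → ♯ ξ θ [ J ] → ∀ {X p q} → Π k X →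
    Prf (θ ∪ B) X p → Prf (θ ∪ B) (negate X) q → p ≤ 2 ^ suc J → q ≤ 2 ^ suc J → ⊥

  -- Truth of the self-consistency sentence

  module _ {k} (no-short : NoShortContradiction k) (θ : Axioms) (θ-RE : REClass ξ θ)
           (A : Arithmetization ξ k (θ ∪ B)) (θ-true : θ ⊆ True) where
    open Arithmetization A

    g : ℕ
    g = ⌜ 1 , Γ ⌝

    θ⁺ : Axioms
    θ⁺ = θ ∪ ｛ SelfCons ｝

    contradiction : Formula 5
    contradiction = subst (var 3F ∷ var 2F ∷ []) Neg
                 ∧′ subst (var 4F ∷ var 3F ∷ var 1F ∷ []) SubstPrf
                 ∧′ subst (var 4F ∷ var 2F ∷ var 0F ∷ []) SubstPrf

    Free : (x y p q : ℕ) → Set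
    Free x y p q = ¬ Sat (q ∷ p ∷ y ∷ x ∷ g ∷ []) contradiction

    -- Codes are bounded along with proofs, as `Scope` bounds all four quantifiers of `SelfCons`.
    FreeBelow : ℕ → Set
    FreeBelow m = ∀ x → x < m → ∀ y → y < m → ∀ p → p < m → ∀ q → q < m → Free x y p q

    FreeBelow-anti : ∀ {m m′} → m ≤ m′ → FreeBelow m′ → FreeBelow m
    FreeBelow-anti m≤m′ free x x< y y< p p< q q< =
      free x (<-≤-trans x< m≤m′) y (<-≤-trans y< m≤m′) p (<-≤-trans p< m≤m′) q (<-≤-trans q< m≤m′)

    g-numeral : (_⊨_↦_ signature) [] (numeral g ∷ []) (g ∷ [])
    g-numeral = pointwise λ { zero → ⟦num⟧ g }

    True-SelfCons : (∀ x y p q → Free x y p q) → True SelfCons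
    True-SelfCons = from (Sat-subst signature g-numeral Γ)

    Good-SelfCons : ∀ J → Good ξ [ + (2 * J) ] SelfCons ⇔ FreeBelow (2 ^ J)
    Good-SelfCons J = ≡.subst (λ m → Good ξ [ h ] SelfCons ⇔ FreeBelow m) (⌈2^½2J⌉≡2^J J) (mk⇔
      (λ good x x< y y< p p< q q< → to (matrix x y p q)
        (to (∀q x y p) (to (∀p x y) (to (∀y x) (to ∀x good x x<) y y<) p p<) q q<))
      (λ free → from ∀x λ x x< → from (∀y x) λ y y< → from (∀p x y) λ p p< → from (∀q x y p) λ q q< →
        from (matrix x y p q) (free x x< y y< p p< q q<)))
      where
      h = + (2 * J)
      -- In `SelfCons` the numeral has been substituted under four quantifiers, hence the four
      -- lifts; `matrix` evaluates them away.
      ¬c = ¬′ subst (lift (lift (lift (lift (numeral g ∷ []))))) contradiction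
      ∀x = Sat-Scope-∀′ [] h (∀′ (∀′ (∀′ ¬c)))
      ∀y = λ x → Sat-Scope-∀′ (x ∷ []) h (∀′ (∀′ ¬c))
      ∀p = λ x y → Sat-Scope-∀′ (y ∷ x ∷ []) h (∀′ ¬c)
      ∀q = λ x y p → Sat-Scope-∀′ (p ∷ y ∷ x ∷ []) h ¬c

      matrix : ∀ x y p q → _ ⇔ Free x y p q
      matrix x y p q = Sat-subst signature
        (↦-lift signature q (↦-lift signature p (↦-lift signature y (↦-lift signature x g-numeral))))
        (¬′ contradiction)

    -- `SubstPrf` speaks of the left-hand system, stability of the right-hand one, where `SelfCons`
    -- counts among the Π₁ sentences added to the base.
    regroup : ((θ ∪ B) ∪ ｛ SelfCons ｝) ≐ (θ⁺ ∪ B)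
    regroup =
        (λ { (inj₁ (inj₁ t)) → inj₁ (inj₁ t) ; (inj₁ (inj₂ b)) → inj₂ b ; (inj₂ s) → inj₁ (inj₂ s) })
      , (λ { (inj₁ (inj₁ t)) → inj₁ (inj₁ t) ; (inj₁ (inj₂ s)) → inj₂ s ; (inj₂ b) → inj₁ (inj₂ b) })

    -- This is the self-reference: by injectivity `g` codes only `Γ`, so the sentence that
    -- `SubstPrf` adds to the axioms is `Γ` at its own code.
    diagonal-unique : ∀ {H} → IsDiagonal ξ g H → H ≡ SelfCons
    diagonal-unique (_ , _ , e , H≡) with refl ← ⌜⌝-injective e = H≡

    SubstPrf⇒Prf : ∀ {t p} → Sat (g ∷ t ∷ p ∷ []) SubstPrf →
                   ∃[ T ] (⌜ T ⌝ˢ ≡ t × Prf (θ⁺ ∪ B) T p)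
    SubstPrf⇒Prf sat with to (SubstPrf-spec _ _ _) sat
    ... | _ , H , T , diag , _ , T≡ , prf with refl ← diagonal-unique diag =
      T , T≡ , Prf-resp-≐ regroup prf

    contradiction⇒Prf : ∀ {x y p q} → Sat (q ∷ p ∷ y ∷ x ∷ g ∷ []) contradiction →
      ∃[ X ] (Π k X × Prf (θ⁺ ∪ B) X p × Prf (θ⁺ ∪ B) (negate X) q)
    contradiction⇒Prf ((neg-xy , prf-x) , prf-y)
      with X , ΠX , X≡ , ¬X≡ ← to (Neg-spec _ _)
             (to (Sat-subst signature (pointwise λ { 0F → refl ; 1F → refl }) Neg) neg-xy)
         | T , T≡ , prf  ← SubstPrf⇒Prf
             (to (Sat-subst signature (pointwise λ { 0F → refl ; 1F → refl ; 2F → refl }) SubstPrf) prf-x)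
         | U , U≡ , prf′ ← SubstPrf⇒Prf
             (to (Sat-subst signature (pointwise λ { 0F → refl ; 1F → refl ; 2F → refl }) SubstPrf) prf-y)
      with refl ← ⌜⌝ˢ-injective (trans T≡ (sym X≡))
         | refl ← ⌜⌝ˢ-injective (trans U≡ (sym ¬X≡))
      = X , ΠX , prf , prf′

    -- True Π₁ sentences are Good at every level, so `SelfCons` alone limits the goodness of `θ⁺`.
    AllGood-θ⁺ : ∀ J → AllGood ξ J θ⁺ ⇔ FreeBelow (2 ^ J)
    AllGood-θ⁺ J = mk⇔
      (λ good → to (Good-SelfCons J) (good (inj₂ refl)))
      (λ { free (inj₁ X∈θ)  → Sat⇒Sat-Scope (+ (2 * J)) (proj₁ θ-RE X∈θ) (θ-true X∈θ)
         ; free (inj₂ refl) → from (Good-SelfCons J) free })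

    ♯-θ⁺ : ∀ {J} → FreeBelow (2 ^ J) → ¬ FreeBelow (2 ^ suc J) → ♯ ξ θ⁺ [ J ]
    ♯-θ⁺ {J} free ¬free = from (AllGood-θ⁺ J) free , λ J′ good → ≮⇒≥ λ J<J′ →
      ¬free (FreeBelow-anti (^-monoʳ-≤ 2 J<J′) (to (AllGood-θ⁺ J′) good))

    free-below : ∀ J → FreeBelow (2 ^ J)
    -- Below 2 ^ 0 only p = 0 is left, and proof numbers are positive.
    free-below zero x _ y _ p p<1 q _ c =
      let _ , _ , prf , _ = contradiction⇒Prf c in <⇒≱ p<1 (Prf-positive prf)
    free-below (suc J) x x< y y< p p< q q< c =
      let _ , ΠX , prf , prf′ = contradiction⇒Prf c
      in no-short (REClass-insert SelfCons-Π₁ θ-RE)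
           -- The quadruple being refuted is itself what keeps `♯` from exceeding J.
           (♯-θ⁺ {J} (free-below J) λ free → free x x< y y< p p< q q< c)
           ΠX prf prf′ (<⇒≤ p<) (<⇒≤ q<)

    SelfCons-true : True SelfCons
    SelfCons-true = True-SelfCons λ x y p q →
      -- The sum dominates all four numbers, and m < 2 ^ m.
      let m = x + y + p + q
          below : ∀ {v} → v ≤ m → v < 2 ^ m
          below v≤m = ≤-<-trans v≤m (n<2^n m)
      in free-below m
           x (below (m≤n⇒m≤n+o q (m≤n⇒m≤n+o p (m≤m+n x y))))
           y (below (m≤n⇒m≤n+o q (m≤n⇒m≤n+o p (m≤n+m y x))))
           p (below (m≤n⇒m≤n+o q (m≤n+m p (x + y))))
           q (below (m≤n+m q (x + y + p)))

    𝔾-true : 𝔾 ξ k θ A ⊆ True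
    𝔾-true (inj₁ (inj₁ X∈θ)) = θ-true X∈θ
    𝔾-true (inj₁ (inj₂ X∈B)) = B-true X∈B
    𝔾-true (inj₂ refl)       = SelfCons-true

    𝔾-consistent : Consistent (𝔾 ξ k θ A)
    𝔾-consistent (X , ⊢X , ⊢¬X) = ⊢⇒True ⊢¬X (⊢⇒True ⊢X)
      where
      ⊢⇒True : ∀ {Y} → 𝔾 ξ k θ A ⊢ Y → True Y
      ⊢⇒True (π , from𝔾 , refl) = sound π (All.map 𝔾-true from𝔾)

  -- Stability rules out short contradictions

  EA-stable⇒no-short : EAStable ξ → NoShortContradiction 1
  EA-stable⇒no-short (e-stable , a-stable) {θ} θ-RE {J} ♯θ {X} {p} {q} ΠX prf prf′ p≤ q≤ =
    Scope-negate-contradiction (+ J) (⌊log₂ q ⌋ ⊖ 2) (⌈2^½⌉-⊖2≤ ⌊log₂ q ⌋ (⌊log₂⌋≤ {J = suc J} q≤)) ΠX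
      (a-stable θ θ-RE [ J ] ♯θ X p ΠX prf p≤)
      (e-stable θ θ-RE [ J ] ♯θ (negate X) q (negate-Π₁ ΠX) prf′ q≤)

  -- A Δ₀ sentence is also Π₁ and has no unbounded quantifier for `Scope` to change, so Good at any
  -- exponent means true. The E-stable case is the same, with Σ₁.
  A-stable⇒0-stable : AStable ξ → ZeroStable ξ
  A-stable⇒0-stable a-stable θ θ-RE s ♯θ X p X∈Δ₀ prf p≤ =
    Good-Δ₀ (½ ξ s) X∈Δ₀ (a-stable θ θ-RE s ♯θ X p (Σ⇒Π (Δ₀⇒Σ X∈Δ₀)) prf p≤)

  E-stable⇒0-stable : EStable ξ → ZeroStable ξ
  E-stable⇒0-stable e-stable θ θ-RE s ♯θ X p X∈Δ₀ prf p≤ =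
    Good-Δ₀ [ _ ] X∈Δ₀ (e-stable θ θ-RE s ♯θ X p (Π⇒Σ (Δ₀⇒Π X∈Δ₀)) prf p≤)

  0-stable⇒no-short : ZeroStable ξ → NoShortContradiction 0
  0-stable⇒no-short 0-stable {θ} θ-RE {J} ♯θ {X} {p} {q} (Δ₀⇒Π X∈Δ₀) prf prf′ p≤ q≤ =
    0-stable θ θ-RE [ J ] ♯θ (¬′ X) q (¬-closed X∈Δ₀)
      -- On Δ₀ sentences the prenex negation is plain `¬′`, so both sentences are Δ₀ and would both
      -- be true.
      (≡.subst (λ Y → Prf (θ ∪ B) Y q) (negate-Δ₀ X∈Δ₀) prf′) q≤
      (0-stable θ θ-RE [ J ] ♯θ X p X∈Δ₀ prf p≤)

theorem6p3 : (ξ : GenericConfiguration) →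
    (EAStable ξ → ConsistencyPreserving ξ 1) ×
    (AStable ξ ⊎ EStable ξ ⊎ ZeroStable ξ → ConsistencyPreserving ξ 0)
theorem6p3 ξ =
    (λ ea → 𝔾-consistent ξ (EA-stable⇒no-short ξ ea))
  , (λ st → 𝔾-consistent ξ (0-stable⇒no-short ξ
      ([ A-stable⇒0-stable ξ , [ E-stable⇒0-stable ξ , id ]′ ]′ st)))
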